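{- It holds that $B_{2}^{m} \subsetneqq B_{2}$, i.e. every graph in $B_2^m$ is in $B_2$, and there is a graph in $B_2$ that is not in $B_2^m$.
   Context: All graphs are finite and simple. A grid consists of horizontal grid lines (rows, increasing from bottom to top) and vertical grid lines (columns, increasing from left to right). A grid point is a crossing of two grid lines. A grid edge is the part of a grid line between two consecutive grid points. A path on a grid consists of two grid points (its end points) and a number of consecutive grid edges connecting them. A bend of a path is a turn of the path at a grid point. An EPG representation of a graph $G$ assigns to each vertex $v$ of $G$ a path $P_v$ on a common grid such that two distinct vertices $v,w$ are adjacent in $G$ if and only if $P_v$ and $P_w$ share at least one grid edge. A path is monotonic if it is ascending in both columns and rows, i.e. it has the shape of a staircase going upwards from left to right. For a nonnegative integer $k$, $B_k$ is the class of all graphs that have an EPG representation in which every path has at most $k$ bends, and $B_k^m$ (the superscript $m$ is just a symbol for "monotonic") is the class of all graphs that have an EPG representation in which every path is monotonic and has at most $k$ bends. -}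

module Defs where

open import Level using (0ℓ)
open import Data.Bool using (if_then_else_)
open import Data.Nat using (ℕ; suc; _+_; _≤_)
open import Data.Fin using (Fin; toℕ)
open import Data.Fin.Properties using (_≟_)
open import Data.List using (List; []; _∷_; length)
open import Data.List.Membership.Propositional using (_∈_)
open import Data.List.Relation.Unary.Linked using (Linked)
open import Data.List.Relation.Unary.Unique.Propositional using (Unique)
open import Data.Product using (_×_; _,_; proj₁; proj₂; ∃₂; Σ-syntax)
open import Data.Sum using (_⊎_)
open import Function using (flip)
open import Function.Bundles using (_⇔_)
open import Relation.Binary using (Rel; Decidable; Symmetric; Irreflexive)
open import Relation.Binary.PropositionalEquality using (_≡_; _≢_)
open import Relation.Nullary using (Dec; does)
open import Relation.Nullary.Decidable using (_×-dec_; _⊎-dec_)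
open import Relation.Unary using (Pred)

record Graph : Set₁ where
  field
    order  : ℕ
    Adj    : Rel (Fin order) 0ℓ
    adj?   : Decidable Adj
    sym    : Symmetric Adj
    irrefl : Irreflexive _≡_ Adj

  Vertex : Set
  Vertex = Fin order

module Grid (cols rows : ℕ) where

  Point : Set
  Point = Fin cols × Fin rows

  col : Point → Fin cols
  col = proj₁

  row : Point → Fin rows
  row = proj₂

  StepRight StepUp Ascend GridEdge : Rel Point 0ℓ
  StepRight p q = toℕ (col q) ≡ suc (toℕ (col p)) × row p ≡ row q
  StepUp    p q = col p ≡ col q × toℕ (row q) ≡ suc (toℕ (row p))
  Ascend    p q = StepRight p q ⊎ StepUp p q
  GridEdge  p q = Ascend p q ⊎ Ascend q p

  -- A path is listed by its successive grid points, from one end point to the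
  -- other.  The points are distinct, so a path neither backtracks nor meets
  -- itself, and its two end points differ.
  record Path : Set where
    field
      points   : List Point
      nonempty : 2 ≤ length points
      linked   : Linked GridEdge points
      distinct : Unique points

  open Path public

  edges : List Point → List (Point × Point)
  edges (p ∷ q ∷ ps) = (p , q) ∷ edges (q ∷ ps)
  edges _            = []

  -- Grid edges are undirected, whereas `edges` records the direction in which
  -- the list traverses them.
  _∋ᵉ_ : Path → Point × Point → Set
  P ∋ᵉ (p , q) = (p , q) ∈ edges (points P) ⊎ (q , p) ∈ edges (points P)

  ShareEdge : Rel Path 0ℓ
  ShareEdge P Q = ∃₂ λ p q → P ∋ᵉ (p , q) × Q ∋ᵉ (p , q)

  -- For consecutive points p, q, r of a path: one of the grid edges pq, qr is
  -- horizontal and the other one is vertical.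
  Turn : Point → Point → Point → Set
  Turn p q r = (row p ≡ row q × col q ≡ col r) ⊎ (col p ≡ col q × row q ≡ row r)

  turn? : ∀ p q r → Dec (Turn p q r)
  turn? p q r = ((row p ≟ row q) ×-dec (col q ≟ col r))
          ⊎-dec ((col p ≟ col q) ×-dec (row q ≟ row r))

  countTurns : List Point → ℕ
  countTurns (p ∷ q ∷ r ∷ ps) =
    (if does (turn? p q r) then 1 else 0) + countTurns (q ∷ r ∷ ps)
  countTurns _ = 0

  bends : Path → ℕ
  bends P = countTurns (points P)

  -- A path has no preferred direction, so the staircase may be listed from
  -- either of its ends.
  Monotonic : Pred Path 0ℓ
  Monotonic P = Linked Ascend (points P) ⊎ Linked (flip Ascend) (points P)

record EPG (G : Graph) : Set where
  open Graph G
  field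
    cols rows : ℕ
  open Grid cols rows
  field
    path       : Vertex → Path
    represents : ∀ v w → v ≢ w → Adj v w ⇔ ShareEdge (path v) (path w)

  AtMostBends : ℕ → Set
  AtMostBends k = ∀ v → bends (path v) ≤ k

  AllMonotonic : Set
  AllMonotonic = ∀ v → Monotonic (path v)

B : ℕ → Pred Graph 0ℓ
B k G = Σ[ R ∈ EPG G ] EPG.AtMostBends R k

Bᵐ : ℕ → Pred Graph 0ℓ
Bᵐ k G = Σ[ R ∈ EPG G ] (EPG.AllMonotonic R × EPG.AtMostBends R k)

{-# OPTIONS --safe #-}

-- Two disjoint paths a, b are joined by many pairwise disjoint paths, the rails,
-- which come in groups of four.  In each group every three rails have a common
-- neighbour, their clasp; the clasps are disjoint from each other and from a, b.
-- With U-shaped clasps such a group can be drawn as a # in which the clasp that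
-- avoids a rail runs along the one parallel to it.
--
-- A monotonic path with two bends is a staircase of three segments.  For all but
-- boundedly many rails one segment lies in a and another one in b, so a clasp can
-- only touch the rail on the line of its third segment.  In a group of four such
-- rails parallel ones lie on different lines, since otherwise the two clasps that
-- bridge them overlap.  No three are parallel, because a staircase has at most two
-- parallel segments.  So two cross two, and then two of the clasps make the same
-- turn at one of the four crossings.
module Submission where

open import Defs
open import Data.Bool using (if_then_else_)
open import Data.Empty using (⊥; ⊥-elim)
open import Data.Fin using (Fin; zero; suc; toℕ; inject₁; fromℕ; combine)
open import Data.Fin.Patterns
import Data.Fin.Properties as Fin
open import Data.List using (List; []; _∷_; _++_; length; lookup; map; allFin)
import Data.List.Membership.DecPropositional as DecMembership
open import Data.List.Membership.Propositional using (find; lose) renaming (_∈_ to _∈ₗ_)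
open import Data.List.Membership.Propositional.Properties using (∈-++⁺ˡ; ∈-++⁺ʳ)
open import Data.List.Relation.Unary.All as All using (All; []; _∷_)
open import Data.List.Relation.Unary.AllPairs using ([]; _∷_)
open import Data.List.Relation.Unary.Any as Any using (Any; here; there; any?)
open import Data.List.Relation.Unary.Any.Properties using (lookup-index)
open import Data.List.Relation.Unary.Linked as Linked using (Linked; [-]; _∷_; linked?)
open import Data.List.Relation.Unary.Unique.Propositional using (Unique)
import Data.List.Relation.Unary.Unique.DecPropositional as DecUnique
open import Data.Nat using (ℕ; zero; suc; pred; _+_; _*_; _≤_; _<_; _⊔_; _⊓_; s≤s; s<s)
open import Data.Nat.Properties
open import Data.Product using (_×_; _,_; proj₁; proj₂; ∃; ∃₂; ∃-syntax)
open import Data.Product.Properties using (≡-dec)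
open import Data.Sum using (_⊎_; inj₁; inj₂; [_,_]′)
open import Data.Sum.Function.Propositional using (_⊎-↔_)
open import Data.Unit using (⊤; tt)
open import Function using (_∘_; id)
open import Function.Bundles using (_⇔_; _↔_; mk⇔; Equivalence; Inverse)
open import Function.Properties.Inverse using (↔-refl; ↔-trans)
open import Relation.Binary using (Decidable; DecidableEquality; tri<; tri≈; tri>)
open import Relation.Binary.PropositionalEquality
open import Relation.Nullary using (Dec; ¬_; ¬?; yes; no; does; contradiction)
open import Relation.Nullary.Decidable
  using (_×-dec_; _⊎-dec_; _→-dec_; map′; from-yes; True; toWitness; dec-true; dec-false)
open import Relation.Unary using (_∈_; _∉_; _⊆_)

-- Staircases as sets of grid edges.

data Axis : Set where
  hor ver : Axis

perp : Axis → Axis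
perp hor = ver
perp ver = hor

perp-involutive : ∀ d → perp (perp d) ≡ d
perp-involutive hor = refl
perp-involutive ver = refl

d≢perp : ∀ {d} → d ≢ perp d
d≢perp {hor} ()
d≢perp {ver} ()

≢⇒perp : ∀ {d d′} → d ≢ d′ → d′ ≡ perp d
≢⇒perp {hor} {hor} d≢d = contradiction refl d≢d
≢⇒perp {hor} {ver} _   = refl
≢⇒perp {ver} {hor} _   = refl
≢⇒perp {ver} {ver} d≢d = contradiction refl d≢d

infix 4 _≟ᵃ_
_≟ᵃ_ : DecidableEquality Axis
hor ≟ᵃ hor = yes refl
hor ≟ᵃ ver = no λ ()
ver ≟ᵃ hor = no λ ()
ver ≟ᵃ ver = yes refl

-- `edge hor ℓ t` joins (t , ℓ) to (t + 1 , ℓ), and `edge ver ℓ t` joins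
-- (ℓ , t) to (ℓ , t + 1).
record Edge : Set where
  constructor edge
  field
    axis : Axis
    line pos : ℕ

record Segment : Set where
  constructor segment
  field
    axis : Axis
    line lo hi : ℕ

infix 4 _∈ˢ_ _∈ᶜ_ _∈ᶜ?_
_∈ˢ_ : Edge → Segment → Set
edge d ℓ t ∈ˢ segment d′ ℓ′ lo hi = d ≡ d′ × ℓ ≡ ℓ′ × lo ≤ t × t < hi

-- The corners are u₀m₀, u₁m₀, u₁m₁, u₂m₁, with the coordinate along `axis`
-- first.  Segments may be empty.
record Staircase : Set where
  field
    axis : Axis
    {u₀ u₁ u₂ m₀ m₁} : ℕ
    u₀≤u₁ : u₀ ≤ u₁
    u₁≤u₂ : u₁ ≤ u₂
    m₀≤m₁ : m₀ ≤ m₁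

  segments : Fin 3 → Segment
  segments 0F = segment axis m₀ u₀ u₁
  segments 1F = segment (perp axis) u₁ m₀ m₁
  segments 2F = segment axis m₁ u₁ u₂

open Staircase

_∈ᶜ_ : Edge → Staircase → Set
e ∈ᶜ S = ∃ λ i → e ∈ˢ segments S i

_∈ᶜ?_ : ∀ e S → Dec (e ∈ᶜ S)
edge d ℓ t ∈ᶜ? S = Fin.any? λ i →
  let segment d′ ℓ′ lo hi = segments S i in
  d ≟ᵃ d′ ×-dec ℓ ≟ ℓ′ ×-dec lo ≤? t ×-dec t <? hi

Meets : Staircase → Staircase → Set
Meets S T = ∃ λ e → e ∈ᶜ S × e ∈ᶜ T

Convex : (ℕ → Set) → Set
Convex I = ∀ {s t u} → I s → I u → s ≤ t → t ≤ u → I t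

-- Only the two outer segments can share a line, namely when `m₀` equals `m₁`. They then abut at
-- `u₁`, so their union is still an interval.
staircase-convex : ∀ S d ℓ → Convex (λ t → edge d ℓ t ∈ᶜ S)
staircase-convex S d ℓ {t = t} (0F , refl , refl , lo , _) (0F , _ , _ , _ , hi) s≤t t≤u =
  0F , refl , refl , ≤-trans lo s≤t , ≤-<-trans t≤u hi
staircase-convex S d ℓ {t = t} (0F , refl , refl , lo , _) (2F , _ , ℓ≡m₁ , _ , hi) s≤t t≤u
  with t <? u₁ S
... | yes t<u₁ = 0F , refl , refl , ≤-trans lo s≤t , t<u₁
... | no  t≮u₁ = 2F , refl , ℓ≡m₁ , ≮⇒≥ t≮u₁ , ≤-<-trans t≤u hi
staircase-convex S d ℓ (2F , refl , refl , lo , _) (2F , _ , _ , _ , hi) s≤t t≤u =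
  2F , refl , refl , ≤-trans lo s≤t , ≤-<-trans t≤u hi
staircase-convex S d ℓ (2F , refl , refl , lo , _) (0F , _ , _ , _ , hi) s≤t t≤u =
  contradiction (≤-trans lo (≤-trans s≤t t≤u)) (<⇒≱ hi)
staircase-convex S d ℓ (1F , d≡d̄ , refl , lo , _) (1F , _ , _ , _ , hi) s≤t t≤u =
  1F , d≡d̄ , refl , ≤-trans lo s≤t , ≤-<-trans t≤u hi
staircase-convex S d ℓ (0F , refl , _) (1F , d≡d̄ , _) = contradiction d≡d̄ d≢perp
staircase-convex S d ℓ (2F , refl , _) (1F , d≡d̄ , _) = contradiction d≡d̄ d≢perp
staircase-convex S d ℓ (1F , d≡d̄ , _) (0F , refl , _) = contradiction d≡d̄ d≢perp
staircase-convex S d ℓ (1F , d≡d̄ , _) (2F , refl , _) = contradiction d≡d̄ d≢perp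

-- Parallel edges on different lines can only come from the two outer segments, so `ℓ` is `m₀` and
-- `ℓ′` is `m₁`. An edge of the other axis then lies in the middle segment, and `k` is `u₁`. The
-- resulting edges are the first ones after the two corners; `no-crossing` matches the first edge
-- for one clasp with the second edge for another.
staircase-corners : ∀ S {d ℓ ℓ′ k s s′ t} → ℓ < ℓ′ →
  edge d ℓ s ∈ᶜ S → edge d ℓ′ s′ ∈ᶜ S → edge (perp d) k t ∈ᶜ S →
  edge (perp d) k ℓ ∈ᶜ S × edge d ℓ′ k ∈ᶜ S
staircase-corners S ℓ<ℓ′ (1F , _ , refl , _) (1F , _ , refl , _) _ = contradiction ℓ<ℓ′ (<-irrefl refl)
staircase-corners S ℓ<ℓ′ (1F , d≡d̄ , _) (0F , refl , _) _ = contradiction d≡d̄ d≢perp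
staircase-corners S ℓ<ℓ′ (1F , d≡d̄ , _) (2F , refl , _) _ = contradiction d≡d̄ d≢perp
staircase-corners S ℓ<ℓ′ (0F , refl , _) (1F , d≡d̄ , _) _ = contradiction d≡d̄ d≢perp
staircase-corners S ℓ<ℓ′ (2F , refl , _) (1F , d≡d̄ , _) _ = contradiction d≡d̄ d≢perp
staircase-corners S ℓ<ℓ′ (0F , refl , refl , _) (0F , _ , refl , _) _ = contradiction ℓ<ℓ′ (<-irrefl refl)
staircase-corners S ℓ<ℓ′ (2F , refl , refl , _) (2F , _ , refl , _) _ = contradiction ℓ<ℓ′ (<-irrefl refl)
staircase-corners S ℓ<ℓ′ (2F , refl , refl , _) (0F , _ , refl , _) _ = contradiction (m₀≤m₁ S) (<⇒≱ ℓ<ℓ′)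
staircase-corners S ℓ<ℓ′ (0F , refl , refl , _) (2F , _ , refl , lo , hi) (0F , d̄≡d , _) =
  contradiction (sym d̄≡d) d≢perp
staircase-corners S ℓ<ℓ′ (0F , refl , refl , _) (2F , _ , refl , lo , hi) (2F , d̄≡d , _) =
  contradiction (sym d̄≡d) d≢perp
staircase-corners S ℓ<ℓ′ (0F , refl , refl , _) (2F , _ , refl , lo , hi) (1F , _ , refl , _) =
  (1F , refl , refl , ≤-refl , ℓ<ℓ′) , (2F , refl , refl , ≤-refl , ≤-<-trans lo hi)

staircase-parallels : ∀ S {d ℓ₁ ℓ₂ ℓ₃ t₁ t₂ t₃} →
  edge d ℓ₁ t₁ ∈ᶜ S → edge d ℓ₂ t₂ ∈ᶜ S → edge d ℓ₃ t₃ ∈ᶜ S →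
  ℓ₁ ≡ ℓ₂ ⊎ ℓ₁ ≡ ℓ₃ ⊎ ℓ₂ ≡ ℓ₃
staircase-parallels S (0F , _ , p , _) (0F , _ , q , _) _ = inj₁ (trans p (sym q))
staircase-parallels S (1F , _ , p , _) (1F , _ , q , _) _ = inj₁ (trans p (sym q))
staircase-parallels S (2F , _ , p , _) (2F , _ , q , _) _ = inj₁ (trans p (sym q))
staircase-parallels S (0F , _ , p , _) (2F , _ , q , _) (0F , _ , r , _) = inj₂ (inj₁ (trans p (sym r)))
staircase-parallels S (0F , _ , p , _) (2F , _ , q , _) (2F , _ , r , _) = inj₂ (inj₂ (trans q (sym r)))
staircase-parallels S (2F , _ , p , _) (0F , _ , q , _) (2F , _ , r , _) = inj₂ (inj₁ (trans p (sym r)))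
staircase-parallels S (2F , _ , p , _) (0F , _ , q , _) (0F , _ , r , _) = inj₂ (inj₂ (trans q (sym r)))
staircase-parallels S (2F , refl , _) (0F , _) (1F , d≡d̄ , _) = contradiction d≡d̄ d≢perp
staircase-parallels S (0F , refl , _) (2F , _) (1F , d≡d̄ , _) = contradiction d≡d̄ d≢perp
staircase-parallels S (0F , refl , _) (1F , d≡d̄ , _) _ = contradiction d≡d̄ d≢perp
staircase-parallels S (2F , refl , _) (1F , d≡d̄ , _) _ = contradiction d≡d̄ d≢perp
staircase-parallels S (1F , d≡d̄ , _) (0F , refl , _) _ = contradiction d≡d̄ d≢perp
staircase-parallels S (1F , d≡d̄ , _) (2F , refl , _) _ = contradiction d≡d̄ d≢perp

-- Bridges between disjoint convex sets.

module _ {I J : ℕ → Set} (convexI : Convex I) (convexJ : Convex J)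
         (disjoint : ∀ {t} → I t → J t → ⊥) where

  -- Otherwise convexity would put a point of one set between two points of the other, so a single
  -- comparison decides which set lies below.
  convex-separated : ∀ {s s′ t t′} → I s → I s′ → J t → J t′ → s < t → s′ < t′
  convex-separated {s} {s′} {t} {t′} Is Is′ Jt Jt′ s<t with s′ <? t | s′ <? t′
  ... | no  s′≮t | _         = ⊥-elim (disjoint (convexI Is Is′ (<⇒≤ s<t) (≮⇒≥ s′≮t)) Jt)
  ... | yes s′<t | no s′≮t′  = ⊥-elim (disjoint Is′ (convexJ Jt′ Jt (≮⇒≥ s′≮t′) (<⇒≤ s′<t)))
  ... | yes _    | yes s′<t′ = s′<t′

  -- The witness is the larger of the two feet in `I`. It lies below both feet in `J`, because all
  -- of `I` lies below all of `J`, so each bridge contains it.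
  bridges-overlap-< : ∀ {K K′ s s′ t t′} → Convex K → Convex K′ →
    I s → I s′ → J t → J t′ → K s → K t → K′ s′ → K′ t′ → s < t → ∃ λ u → K u × K′ u
  bridges-overlap-< {s = s} {s′} {t} {t′} convexK convexK′ Is Is′ Jt Jt′ Ks Kt K′s′ K′t′ s<t =
    s ⊔ s′ ,
    convexK Ks Kt (m≤m⊔n s s′) (⊔-lub (<⇒≤ s<t) (<⇒≤ (convex-separated Is Is′ Jt Jt s<t))) ,
    convexK′ K′s′ K′t′ (m≤n⊔m s s′)
      (⊔-lub (<⇒≤ (convex-separated Is Is Jt Jt′ s<t)) (<⇒≤ (convex-separated Is Is′ Jt Jt′ s<t)))

bridges-overlap : ∀ {I J K K′ : ℕ → Set} {s s′ t t′} →
  Convex I → Convex J → Convex K → Convex K′ → (∀ {u} → I u → J u → ⊥) →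
  I s → I s′ → J t → J t′ → K s → K t → K′ s′ → K′ t′ → ∃ λ u → K u × K′ u
bridges-overlap {I} {J} {s = s} {t = t} cI cJ cK cK′ disjoint Is Is′ Jt Jt′ Ks Kt K′s′ K′t′
  with <-cmp s t
... | tri< s<t _ _  = bridges-overlap-< {I} {J} cI cJ disjoint cK cK′ Is Is′ Jt Jt′ Ks Kt K′s′ K′t′ s<t
... | tri≈ _ refl _ = ⊥-elim (disjoint Is Jt)
... | tri> _ _ t<s  = bridges-overlap-< {J} {I} cJ cI (λ Ju Iu → disjoint Iu Ju) cK cK′
                        Jt Jt′ Is Is′ Kt Ks K′t′ K′s′ t<s

-- Four rails whose triples are clasped.

Distinct : (i j k l : Fin 4) → Set
Distinct i j k l = Unique (i ∷ j ∷ k ∷ l ∷ [])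

distinct-swap₁₂ : ∀ {i j k l} → Distinct i j k l → Distinct j i k l
distinct-swap₁₂ ((ij ∷ ik ∷ il ∷ []) ∷ (jk ∷ jl ∷ []) ∷ u) =
  (≢-sym ij ∷ jk ∷ jl ∷ []) ∷ (ik ∷ il ∷ []) ∷ u

distinct-swap₂₃ : ∀ {i j k l} → Distinct i j k l → Distinct i k j l
distinct-swap₂₃ ((ij ∷ ik ∷ il ∷ []) ∷ (jk ∷ jl ∷ []) ∷ (kl ∷ []) ∷ _) =
  (ik ∷ ij ∷ il ∷ []) ∷ (≢-sym jk ∷ kl ∷ []) ∷ (jl ∷ []) ∷ [] ∷ []

distinct-rotate : ∀ {i j k l} → Distinct i j k l → Distinct k l i j
distinct-rotate ((ij ∷ ik ∷ il ∷ []) ∷ (jk ∷ jl ∷ []) ∷ (kl ∷ []) ∷ _) =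
  (kl ∷ ≢-sym ik ∷ ≢-sym jk ∷ []) ∷ (≢-sym il ∷ ≢-sym jl ∷ []) ∷ (ij ∷ []) ∷ [] ∷ []

distinct : ∀ i j k l → {True (DecUnique.unique? Fin._≟_ (i ∷ j ∷ k ∷ l ∷ []))} → Distinct i j k l
distinct i j k l {u} = toWitness u

module _ (rail clasp : Fin 4 → Staircase) (axis : Fin 4 → Axis) (line : Fin 4 → ℕ)
         (rails-disjoint  : ∀ {i j} → i ≢ j → ¬ Meets (rail i) (rail j))
         (clasps-disjoint : ∀ {i j} → i ≢ j → ¬ Meets (clasp i) (clasp j))
         (touch : ∀ {i j} → i ≢ j →
            ∃ λ t → edge (axis j) (line j) t ∈ᶜ clasp i × edge (axis j) (line j) t ∈ᶜ rail j) where

  touch-along : ∀ {d i j} → axis j ≡ d → i ≢ j →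
    ∃ λ t → edge d (line j) t ∈ᶜ clasp i × edge d (line j) t ∈ᶜ rail j
  touch-along refl i≢j = touch i≢j

  clasp-along : ∀ {d i j} → axis j ≡ d → i ≢ j → ∃ λ t → edge d (line j) t ∈ᶜ clasp i
  clasp-along j∥ i≢j = let t , t∈clasp , _ = touch-along j∥ i≢j in t , t∈clasp

  -- On a common line the rails `i` and `j` occupy disjoint convex sets. The clasps `k` and `l` each
  -- touch both rails there, so `bridges-overlap` gives these clasps a common edge.
  parallel⇒line≢ : ∀ {i j k l} → Distinct i j k l → axis i ≡ axis j → line i ≢ line j
  parallel⇒line≢ {i} {j} {k} {l} ((i≢j ∷ i≢k ∷ i≢l ∷ []) ∷ (j≢k ∷ j≢l ∷ []) ∷ (k≢l ∷ []) ∷ _) i∥j ℓᵢ≡ℓⱼ =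
    let _ , sk , si    = touch (≢-sym i≢k)
        _ , s′l , s′i  = touch (≢-sym i≢l)
        _ , tk , tj    = along-ℓᵢ (touch-along (sym i∥j) (≢-sym j≢k))
        _ , t′l , t′j  = along-ℓᵢ (touch-along (sym i∥j) (≢-sym j≢l))
        _ , uk , ul    = bridges-overlap {on (rail i)} {on (rail j)} {on (clasp k)} {on (clasp l)}
          (convex (rail i)) (convex (rail j)) (convex (clasp k)) (convex (clasp l))
          (λ p q → rails-disjoint i≢j (_ , p , q))
          si s′i tj t′j sk tk s′l t′l
    in clasps-disjoint k≢l (_ , uk , ul)
    where
    on : Staircase → ℕ → Set
    on S t = edge (axis i) (line i) t ∈ᶜ S
    convex : ∀ S → Convex (on S)
    convex S = staircase-convex S (axis i) (line i)
    along-ℓᵢ : ∀ {S T} → (∃ λ t → edge (axis i) (line j) t ∈ᶜ S × edge (axis i) (line j) t ∈ᶜ T) →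
      ∃ λ t → on S t × on T t
    along-ℓᵢ {S} {T} =
      subst (λ ℓ → ∃ λ t → edge (axis i) ℓ t ∈ᶜ S × edge (axis i) ℓ t ∈ᶜ T) (sym ℓᵢ≡ℓⱼ)

  -- Clasp `l` touches all three rails, so it would have edges on three parallel lines, and these
  -- differ by `parallel⇒line≢`.
  no-three-parallel : ∀ {i j k l} → Distinct i j k l → axis i ≡ axis j → axis i ≡ axis k → ⊥
  no-three-parallel {l = l} u@((_ ∷ _ ∷ i≢l ∷ []) ∷ (_ ∷ j≢l ∷ []) ∷ (k≢l ∷ []) ∷ _) i∥j i∥k
    with staircase-parallels (clasp l) (proj₂ (clasp-along refl (≢-sym i≢l)))
           (proj₂ (clasp-along (sym i∥j) (≢-sym j≢l))) (proj₂ (clasp-along (sym i∥k) (≢-sym k≢l)))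
  ... | inj₁ ℓᵢ≡ℓⱼ        = parallel⇒line≢ u i∥j ℓᵢ≡ℓⱼ
  ... | inj₂ (inj₁ ℓᵢ≡ℓₖ) = parallel⇒line≢ (distinct-swap₂₃ u) i∥k ℓᵢ≡ℓₖ
  ... | inj₂ (inj₂ ℓⱼ≡ℓₖ) =
    parallel⇒line≢ (distinct-swap₂₃ (distinct-swap₁₂ u)) (trans (sym i∥j) i∥k) ℓⱼ≡ℓₖ

  -- Where the lower of the rails i, j crosses the upper of the rails k, l, both
  -- clasp k and clasp j turn, and they turn the same way.
  no-crossing : ∀ {i j k l} → Distinct i j k l →
    axis j ≡ axis i → axis k ≡ perp (axis i) → axis l ≡ perp (axis i) →
    line i < line j → line k < line l → ⊥
  no-crossing {i} {j} {k} {l} ((i≢j ∷ i≢k ∷ i≢l ∷ []) ∷ (j≢k ∷ j≢l ∷ []) ∷ (k≢l ∷ []) ∷ _)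
    j∥i k⊥i l⊥i ℓᵢ<ℓⱼ ℓₖ<ℓₗ =
    clasps-disjoint (≢-sym j≢k) (_ , turnₖ , turnⱼ)
    where
    turnₖ : edge (perp (axis i)) (line l) (line i) ∈ᶜ clasp k
    turnₖ = proj₁ (staircase-corners (clasp k) ℓᵢ<ℓⱼ (proj₂ (clasp-along refl (≢-sym i≢k)))
      (proj₂ (clasp-along j∥i (≢-sym j≢k))) (proj₂ (clasp-along l⊥i k≢l)))
    turnⱼ : edge (perp (axis i)) (line l) (line i) ∈ᶜ clasp j
    turnⱼ = proj₂ (staircase-corners (clasp j) ℓₖ<ℓₗ (proj₂ (clasp-along k⊥i j≢k))
      (proj₂ (clasp-along l⊥i j≢l))
      (proj₂ (clasp-along (sym (perp-involutive (axis i))) (≢-sym i≢j))))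

  sort-parallel : ∀ {i j k l} → Distinct i j k l → axis i ≡ axis j →
    ∃₂ λ i′ j′ → Distinct i′ j′ k l × axis i′ ≡ axis i × axis j′ ≡ axis i × line i′ < line j′
  sort-parallel {i} {j} u i∥j with <-cmp (line i) (line j)
  ... | tri< ℓᵢ<ℓⱼ _ _ = i , j , u , refl , sym i∥j , ℓᵢ<ℓⱼ
  ... | tri≈ _ ℓᵢ≡ℓⱼ _ = contradiction ℓᵢ≡ℓⱼ (parallel⇒line≢ u i∥j)
  ... | tri> _ _ ℓⱼ<ℓᵢ = j , i , distinct-swap₁₂ u , sym i∥j , refl , ℓⱼ<ℓᵢ

  no-crossing-pairs : ∀ {i j k l} → Distinct i j k l →
    axis i ≡ axis j → axis k ≡ axis l → axis k ≡ perp (axis i) → ⊥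
  no-crossing-pairs u i∥j k∥l k⊥i
    with _ , _ , u′ , i′∥i , j′∥i , ℓᵢ<ℓⱼ ← sort-parallel u i∥j
    with _ , _ , u″ , k′∥k , l′∥k , ℓₖ<ℓₗ ← sort-parallel (distinct-rotate u′) k∥l =
    no-crossing (distinct-rotate u″) (trans j′∥i (sym i′∥i))
      (trans k′∥k k⊥i′) (trans l′∥k k⊥i′) ℓᵢ<ℓⱼ ℓₖ<ℓₗ
    where
    k⊥i′ = trans k⊥i (cong perp (sym i′∥i))

  -- Comparing with rail `0F` suffices: as there are only two directions, either three rails are
  -- parallel or the four split into two parallel pairs.
  no-four-clasped-rails : ⊥
  no-four-clasped-rails
    with axis 0F ≟ᵃ axis 1F | axis 0F ≟ᵃ axis 2F | axis 0F ≟ᵃ axis 3F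
  ... | yes p | yes q | _     = no-three-parallel (distinct 0F 1F 2F 3F) p q
  ... | yes p | no _  | yes r = no-three-parallel (distinct 0F 1F 3F 2F) p r
  ... | no _  | yes q | yes r = no-three-parallel (distinct 0F 2F 3F 1F) q r
  ... | no p  | no q  | no r  = no-three-parallel (distinct 1F 2F 3F 0F)
    (trans (≢⇒perp p) (sym (≢⇒perp q))) (trans (≢⇒perp p) (sym (≢⇒perp r)))
  ... | yes p | no q  | no r  =
    no-crossing-pairs (distinct 0F 1F 2F 3F) p (trans (≢⇒perp q) (sym (≢⇒perp r))) (≢⇒perp q)
  ... | no p  | yes q | no r  =
    no-crossing-pairs (distinct 0F 2F 1F 3F) q (trans (≢⇒perp p) (sym (≢⇒perp r))) (≢⇒perp p)
  ... | no p  | no q  | yes r =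
    no-crossing-pairs (distinct 0F 3F 1F 2F) r (trans (≢⇒perp p) (sym (≢⇒perp q))) (≢⇒perp p)

-- Rails and the segment ends of the two paths they join.

ends : Segment → List Edge
ends (segment d ℓ lo hi) = edge d ℓ lo ∷ edge d ℓ (pred hi) ∷ []

-- Edges are named by their lower end points, so a nonempty segment has its last edge at `pred hi`.
-- An empty segment contributes edges outside it; this is harmless, since the pigeonhole argument
-- only counts list positions.
segment-ends : Staircase → List Edge
segment-ends S = ends (segments S 0F) ++ ends (segments S 1F) ++ ends (segments S 2F)

end∈segment-ends : ∀ S i {e} → e ∈ₗ ends (segments S i) → e ∈ₗ segment-ends S
end∈segment-ends S 0F e∈ = ∈-++⁺ˡ e∈
end∈segment-ends S 1F e∈ = ∈-++⁺ʳ (ends (segments S 0F)) (∈-++⁺ˡ e∈)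
end∈segment-ends S 2F e∈ = ∈-++⁺ʳ (ends (segments S 0F)) (∈-++⁺ʳ (ends (segments S 1F)) e∈)

-- Walking along C from an edge in A to one outside A passes an end of A.
contained-or-end : ∀ A C {e f} → e ∈ˢ A → e ∈ˢ C → f ∈ˢ C →
  f ∈ˢ A ⊎ Any (_∈ˢ C) (ends A)
contained-or-end (segment d ℓ lo hi) C {edge _ _ s} {edge _ _ t}
  (refl , refl , lo≤s , s<hi) (refl , refl , lo′≤s , s<hi′) (refl , refl , lo′≤t , t<hi′)
  with t <? lo | t <? hi
... | yes t<lo | _        = inj₂ (here (refl , refl , ≤-trans lo′≤t (<⇒≤ t<lo) , ≤-<-trans lo≤s s<hi′))
... | no  t≮lo | yes t<hi = inj₁ (refl , refl , ≮⇒≥ t≮lo , t<hi)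
... | no  _    | no  t≮hi = inj₂ (there (here (refl , refl , ≤-trans lo′≤s (<⇒≤pred s<hi) ,
                              ≤-<-trans pred[n]≤n (≤-<-trans (≮⇒≥ t≮hi) t<hi′))))

third : (i j : Fin 3) → i ≢ j → ∃ λ (k : Fin 3) → ∀ (l : Fin 3) → l ≡ i ⊎ l ≡ j ⊎ l ≡ k
third = from-yes (Fin.all? {3} λ i → Fin.all? λ j → ¬? (i Fin.≟ j) →-dec
  Fin.any? λ k → Fin.all? λ l → l Fin.≟ i ⊎-dec (l Fin.≟ j ⊎-dec l Fin.≟ k))

StraightOutside : (A B S : Staircase) → Set
StraightOutside A B S = ∃₂ λ d ℓ → ∀ {e} → e ∈ᶜ S →
  e ∈ᶜ A ⊎ e ∈ᶜ B ⊎ (Edge.axis e ≡ d × Edge.line e ≡ ℓ)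

-- Unless a segment of S that meets A ∪ B contains an end of a segment of A or B,
-- one segment of S lies in A and another one in B, which leaves only the third.
connector-straight : ∀ {A B S} → ¬ Meets A B → Meets S A → Meets S B →
  StraightOutside A B S ⊎ Any (_∈ᶜ S) (segment-ends A ++ segment-ends B)
connector-straight {A} {B} {S} A∦B (e , (i , e∈Sᵢ) , (m , e∈A)) (f , (j , f∈Sⱼ) , (n , f∈B))
  with any? (_∈ᶜ? S) (segment-ends A ++ segment-ends B)
... | yes end∈S = inj₂ end∈S
... | no  end∉S = inj₁ (let k , covered = third i j i≢j in straight k covered)
  where
  Sᵢ⊆A : ∀ {g} → g ∈ˢ segments S i → g ∈ᶜ A
  Sᵢ⊆A g∈Sᵢ with contained-or-end (segments A m) (segments S i) e∈A e∈Sᵢ g∈Sᵢ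
  ... | inj₁ g∈A = m , g∈A
  ... | inj₂ end with _ , e∈ends , e∈S ← find end =
    contradiction (lose (∈-++⁺ˡ (end∈segment-ends A m e∈ends)) (i , e∈S)) end∉S
  Sⱼ⊆B : ∀ {g} → g ∈ˢ segments S j → g ∈ᶜ B
  Sⱼ⊆B g∈Sⱼ with contained-or-end (segments B n) (segments S j) f∈B f∈Sⱼ g∈Sⱼ
  ... | inj₁ g∈B = n , g∈B
  ... | inj₂ end with _ , e∈ends , e∈S ← find end =
    contradiction (lose (∈-++⁺ʳ (segment-ends A) (end∈segment-ends B n e∈ends)) (j , e∈S)) end∉S
  i≢j : i ≢ j
  i≢j refl = A∦B (f , Sᵢ⊆A f∈Sⱼ , n , f∈B)
  straight : ∀ k → (∀ l → l ≡ i ⊎ l ≡ j ⊎ l ≡ k) → StraightOutside A B S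
  straight k covered = _ , _ , outside
    where
    outside : ∀ {g} → g ∈ᶜ S → g ∈ᶜ A ⊎ g ∈ᶜ B ⊎
      (Edge.axis g ≡ Segment.axis (segments S k) × Edge.line g ≡ Segment.line (segments S k))
    outside (l , g∈Sₗ@(axis≡ , line≡ , _)) with covered l
    ... | inj₁ refl        = inj₁ (Sᵢ⊆A g∈Sₗ)
    ... | inj₂ (inj₁ refl) = inj₂ (inj₁ (Sⱼ⊆B g∈Sₗ))
    ... | inj₂ (inj₂ refl) = inj₂ (inj₂ (axis≡ , line≡))

∀-⊎ : ∀ {n} {P Q : Fin n → Set} → (∀ i → P i ⊎ Q i) → (∀ i → P i) ⊎ ∃ Q
∀-⊎ {zero}  f = inj₁ λ ()
∀-⊎ {suc n} f with f 0F | ∀-⊎ (f ∘ suc)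
... | inj₂ q | _            = inj₂ (0F , q)
... | inj₁ _ | inj₂ (i , q) = inj₂ (suc i , q)
... | inj₁ p | inj₁ ps      = inj₁ λ { 0F → p ; (suc i) → ps i }

-- The segments of two staircases have twelve ends, so thirteen groups suffice.
no-clasped-rails : ∀ {A B} (rail clasp : Fin 13 → Fin 4 → Staircase) →
  ¬ Meets A B →
  (∀ g i → Meets (rail g i) A) →
  (∀ g i → Meets (rail g i) B) →
  (∀ {g h i j} → (g , i) ≢ (h , j) → ¬ Meets (rail g i) (rail h j)) →
  (∀ g i → ¬ Meets (clasp g i) A) →
  (∀ g i → ¬ Meets (clasp g i) B) →
  (∀ g {i j} → i ≢ j → ¬ Meets (clasp g i) (clasp g j)) →
  (∀ g {i j} → i ≢ j → Meets (clasp g i) (rail g j)) →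
  ⊥
no-clasped-rails {A} {B} rail clasp A∦B rail-A rail-B rails-disjoint
  clasp-A clasp-B clasps-disjoint clasp-rail =
  let g , h , g<h , same = Fin.pigeonhole (s<s ≤-refl) (λ g → Any.index (proj₂ (bent g)))
  in rails-disjoint (Fin.<⇒≢ g<h ∘ cong proj₁)
    ( _
    , lookup-index (proj₂ (bent g))
    , subst (λ n → lookup (segment-ends A ++ segment-ends B) n ∈ᶜ rail h (proj₁ (bent h))) (sym same)
        (lookup-index (proj₂ (bent h))))
  where
  -- By `no-four-clasped-rails` the rails of a group cannot all be straight outside `A` and `B`, so
  -- each group has a rail through a listed end.
  bent : ∀ g → ∃ λ i → Any (_∈ᶜ rail g i) (segment-ends A ++ segment-ends B)
  bent g = [ ⊥-elim ∘ all-straight⇒⊥ , id ]′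
    (∀-⊎ (λ i → connector-straight A∦B (rail-A g i) (rail-B g i)))
    where
    all-straight⇒⊥ : (∀ i → StraightOutside A B (rail g i)) → ⊥
    all-straight⇒⊥ straight = no-four-clasped-rails (rail g) (clasp g) dir ℓ
      (λ i≢j → rails-disjoint (i≢j ∘ cong proj₂)) (clasps-disjoint g) touch
      where
      dir = λ i → proj₁ (straight i)
      ℓ = λ i → proj₁ (proj₂ (straight i))
      touch : ∀ {i j} → i ≢ j →
        ∃ λ t → edge (dir j) (ℓ j) t ∈ᶜ clasp g i × edge (dir j) (ℓ j) t ∈ᶜ rail g j
      touch {i} {j} i≢j
        with e , e∈clasp , e∈rail ← clasp-rail g i≢j
        with proj₂ (proj₂ (straight j)) e∈rail
      ... | inj₁ e∈A                  = contradiction (e , e∈clasp , e∈A) (clasp-A g i)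
      ... | inj₂ (inj₁ e∈B)           = contradiction (e , e∈clasp , e∈B) (clasp-B g i)
      ... | inj₂ (inj₂ (refl , refl)) = Edge.pos e , e∈clasp , e∈rail

-- Walks with alternating axes.

open Equivalence using (to; from)

-- A monotonic path may be listed from either end. The sense records which, so that one argument
-- serves both listings.
data Sense : Set where
  up down : Sense

Next Leq : Sense → ℕ → ℕ → Set
Next up   s t = t ≡ suc s
Next down s t = s ≡ suc t
Leq up   s t = s ≤ t
Leq down s t = t ≤ s

-- The positions of the edges passed on the way from `s` to `t`. As an edge is named by its lower
-- end point, the interval is closed below and open above in both senses.
Within : Sense → ℕ → ℕ → ℕ → Set
Within up   s t u = s ≤ u × u < t
Within down s t u = t ≤ u × u < s

lower : Sense → ℕ → ℕ → ℕ
lower up   s t = s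
lower down s t = t

next⇒leq : ∀ o {s t} → Next o s t → Leq o s t
next⇒leq up   refl = n≤1+n _
next⇒leq down refl = n≤1+n _

next⇒≢ : ∀ o {s t} → Next o s t → s ≢ t
next⇒≢ up   refl = λ ()
next⇒≢ down refl = λ ()

leq-refl : ∀ o {s} → Leq o s s
leq-refl up   = ≤-refl
leq-refl down = ≤-refl

leq-trans : ∀ o {s t u} → Leq o s t → Leq o t u → Leq o s u
leq-trans up   p q = ≤-trans p q
leq-trans down p q = ≤-trans q p

¬within-refl : ∀ o {s t} → ¬ Within o s s t
¬within-refl up   (s≤t , t<s) = <⇒≱ t<s s≤t
¬within-refl down (s≤t , t<s) = <⇒≱ t<s s≤t

within-next⁺ : ∀ o {s t v u} → Next o s t → Leq o t v →
  u ≡ lower o s t ⊎ Within o t v u → Within o s v u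
within-next⁺ up   refl t≤v (inj₁ refl)        = ≤-refl , t≤v
within-next⁺ up   refl t≤v (inj₂ (t≤u , u<v)) = ≤-trans (n≤1+n _) t≤u , u<v
within-next⁺ down refl v≤t (inj₁ refl)        = v≤t , ≤-refl
within-next⁺ down refl v≤t (inj₂ (v≤u , u<t)) = v≤u , ≤-trans u<t (n≤1+n _)

within-next⁻ : ∀ o {s t v u} → Next o s t →
  Within o s v u → u ≡ lower o s t ⊎ Within o t v u
within-next⁻ up refl (s≤u , u<v) with m≤n⇒m<n∨m≡n s≤u
... | inj₁ s<u  = inj₂ (s<u , u<v)
... | inj₂ refl = inj₁ refl
within-next⁻ down refl (v≤u , s≤s u≤t) with m≤n⇒m<n∨m≡n u≤t
... | inj₁ u<t  = inj₂ (v≤u , u<t)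
... | inj₂ refl = inj₁ refl

-- A walk leaves the point with coordinate s along d and m across d, and turns
-- at each of the listed coordinates, which alternate between the two axes.
OnWalk : Sense → Axis → ℕ → ℕ → List ℕ → Edge → Set
OnWalk o d s m []       e            = ⊥
OnWalk o d s m (t ∷ ts) e =
  (Edge.axis e ≡ d × Edge.line e ≡ m × Within o s t (Edge.pos e)) ⊎ OnWalk o (perp d) m t ts e

Ordered : Sense → ℕ → ℕ → List ℕ → Set
Ordered o s m []       = ⊤
Ordered o s m (t ∷ ts) = Leq o s t × Ordered o m t ts

-- A `down` walk passes its staircase backwards, so its first run is segment `2F` and its last run
-- is segment `0F`.
staircase : ∀ o d s m t₁ t₂ t₃ → Ordered o s m (t₁ ∷ t₂ ∷ t₃ ∷ []) →
  ∃ λ S → ∀ e → e ∈ᶜ S ⇔ OnWalk o d s m (t₁ ∷ t₂ ∷ t₃ ∷ []) e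
staircase up d s m t₁ t₂ t₃ (s≤t₁ , m≤t₂ , t₁≤t₃ , _) =
  record { axis = d ; u₀≤u₁ = s≤t₁ ; u₁≤u₂ = t₁≤t₃ ; m₀≤m₁ = m≤t₂ } , λ e → mk⇔
    (λ { (0F , w) → inj₁ w ; (1F , w) → inj₂ (inj₁ w)
       ; (2F , d≡ , w) → inj₂ (inj₂ (inj₁ (trans d≡ (sym (perp-involutive d)) , w))) })
    (λ { (inj₁ w) → 0F , w ; (inj₂ (inj₁ w)) → 1F , w
       ; (inj₂ (inj₂ (inj₁ (d≡ , w)))) → 2F , trans d≡ (perp-involutive d) , w })
staircase down d s m t₁ t₂ t₃ (t₁≤s , t₂≤m , t₃≤t₁ , _) =
  record { axis = d ; u₀≤u₁ = t₃≤t₁ ; u₁≤u₂ = t₁≤s ; m₀≤m₁ = t₂≤m } , λ e → mk⇔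
    (λ { (2F , w) → inj₁ w ; (1F , w) → inj₂ (inj₁ w)
       ; (0F , d≡ , w) → inj₂ (inj₂ (inj₁ (trans d≡ (sym (perp-involutive d)) , w))) })
    (λ { (inj₁ w) → 2F , w ; (inj₂ (inj₁ w)) → 1F , w
       ; (inj₂ (inj₂ (inj₁ (d≡ , w)))) → 0F , trans d≡ (perp-involutive d) , w })

-- Missing turns are supplied by repeating a coordinate already reached: the added runs have length
-- zero and contain no edge.
walk-staircase : ∀ o d s m t₁ ts → length ts ≤ 2 → Ordered o s m (t₁ ∷ ts) →
  ∃ λ S → ∀ e → e ∈ᶜ S ⇔ OnWalk o d s m (t₁ ∷ ts) e
walk-staircase o d s m t₁ [] _ (s≤t₁ , _) =
  let S , S⇔ = staircase o d s m t₁ m t₁ (s≤t₁ , leq-refl o , leq-refl o , tt)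
  in S , λ e → mk⇔
    ((λ { (inj₁ w)                           → inj₁ w
        ; (inj₂ (inj₁ (_ , _ , w)))          → ⊥-elim (¬within-refl o w)
        ; (inj₂ (inj₂ (inj₁ (_ , _ , w)))) → ⊥-elim (¬within-refl o w) }) ∘ to (S⇔ e))
    (λ { (inj₁ w) → from (S⇔ e) (inj₁ w) ; (inj₂ ()) })
walk-staircase o d s m t₁ (t₂ ∷ []) _ (s≤t₁ , m≤t₂ , _) =
  let S , S⇔ = staircase o d s m t₁ t₂ t₁ (s≤t₁ , m≤t₂ , leq-refl o , tt)
  in S , λ e → mk⇔
    ((λ { (inj₁ w)                           → inj₁ w
        ; (inj₂ (inj₁ w))                    → inj₂ (inj₁ w)
        ; (inj₂ (inj₂ (inj₁ (_ , _ , w)))) → ⊥-elim (¬within-refl o w) }) ∘ to (S⇔ e))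
    (λ { (inj₁ w)        → from (S⇔ e) (inj₁ w)
       ; (inj₂ (inj₁ w)) → from (S⇔ e) (inj₂ (inj₁ w))
       ; (inj₂ (inj₂ ())) })
walk-staircase o d s m t₁ (t₂ ∷ t₃ ∷ []) _ ordered = staircase o d s m t₁ t₂ t₃ ordered
walk-staircase o d s m _ (_ ∷ _ ∷ _ ∷ _) (s≤s (s≤s ())) _

-- Monotonic grid paths as walks.

module _ {cols rows : ℕ} where
  open Grid cols rows

  coord : Axis → Point → ℕ
  coord hor p = toℕ (col p)
  coord ver p = toℕ (row p)

  coord-injective : ∀ d {p q} → coord d p ≡ coord d q → coord (perp d) p ≡ coord (perp d) q → p ≡ q
  coord-injective hor x y = cong₂ _,_ (Fin.toℕ-injective x) (Fin.toℕ-injective y)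
  coord-injective ver y x = cong₂ _,_ (Fin.toℕ-injective x) (Fin.toℕ-injective y)

  Joins : Edge → Point → Point → Set
  Joins (edge d ℓ t) p q =
    coord d p ≡ t × coord d q ≡ suc t × coord (perp d) p ≡ ℓ × coord (perp d) q ≡ ℓ

  joins-unique : ∀ e {p q p′ q′} → Joins e p q → Joins e p′ q′ → p ≡ p′ × q ≡ q′
  joins-unique (edge d ℓ t) (pt , qt , pℓ , qℓ) (pt′ , qt′ , pℓ′ , qℓ′) =
    coord-injective d (trans pt (sym pt′)) (trans pℓ (sym pℓ′)) ,
    coord-injective d (trans qt (sym qt′)) (trans qℓ (sym qℓ′))

  ascend⇒joins : ∀ {p q} → Ascend p q → ∃ λ e → Joins e p q
  ascend⇒joins (inj₁ (x , refl)) = edge hor _ _ , refl , x , refl , refl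
  ascend⇒joins (inj₂ (refl , y)) = edge ver _ _ , refl , y , refl , refl

  infix 4 _Contains_ _Traverses_
  _Traverses_ : List Point → Edge → Set
  ps Traverses e = ∃₂ λ p q → Joins e p q × ((p , q) ∈ₗ edges ps ⊎ (q , p) ∈ₗ edges ps)

  _Contains_ : Path → Edge → Set
  P Contains e = points P Traverses e

  edge⇒gridEdge : ∀ {ps p q} → Linked GridEdge ps → (p , q) ∈ₗ edges ps → GridEdge p q
  edge⇒gridEdge (r ∷ _)  (here refl) = r
  edge⇒gridEdge (_ ∷ rs) (there e)   = edge⇒gridEdge rs e

  -- A shared pair is a grid edge because paths are linked, and its ascending orientation names an
  -- `Edge`. Conversely an `Edge` determines both its end points, so the two paths use the same
  -- pair.
  shareEdge⇔ : ∀ P Q → ShareEdge P Q ⇔ (∃ λ e → P Contains e × Q Contains e)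
  shareEdge⇔ P Q = mk⇔ fwd bwd
    where
    gridEdge : ∀ {p q} → P ∋ᵉ (p , q) → GridEdge p q
    gridEdge (inj₁ e) = edge⇒gridEdge (linked P) e
    gridEdge (inj₂ e) = [ inj₂ , inj₁ ]′ (edge⇒gridEdge (linked P) e)
    flipped : ∀ {R : Path} {p q} → R ∋ᵉ (p , q) → R ∋ᵉ (q , p)
    flipped = [ inj₂ , inj₁ ]′
    fwd : ShareEdge P Q → ∃ λ e → P Contains e × Q Contains e
    fwd (p , q , P∋ , Q∋) with gridEdge P∋
    ... | inj₁ asc = let e , j = ascend⇒joins asc in e , (p , q , j , P∋) , (p , q , j , Q∋)
    ... | inj₂ asc = let e , j = ascend⇒joins asc
                     in e , (q , p , j , flipped {P} P∋) , (q , p , j , flipped {Q} Q∋)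
    bwd : (∃ λ e → P Contains e × Q Contains e) → ShareEdge P Q
    bwd (e , (p , q , j , P∋) , (p′ , q′ , j′ , Q∋)) with refl , refl ← joins-unique e j j′ =
      p , q , P∋ , Q∋

  record Step (o : Sense) (d : Axis) (p q : Point) : Set where
    constructor step
    field
      next : Next o (coord d p) (coord d q)
      same : coord (perp d) p ≡ coord (perp d) q

  open Step

  ascend⇒step : ∀ {p q} → Ascend p q → ∃ λ d → Step up d p q
  ascend⇒step (inj₁ (x , refl)) = hor , step x refl
  ascend⇒step (inj₂ (refl , y)) = ver , step y refl

  descend⇒step : ∀ {p q} → Ascend q p → ∃ λ d → Step down d p q
  descend⇒step (inj₁ (x , refl)) = hor , step x refl
  descend⇒step (inj₂ (refl , y)) = ver , step y refl

  -- A turn keeps the column or the row fixed in one step and the other coordinate in the next,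
  -- whereas both steps along `d` change the same coordinate. With `perp-steps⇒turn` this makes
  -- `countTurns` count the changes of axis.
  turn⇒¬straight : ∀ o {d p q r} → Turn p q r → Step o d p q → ¬ Step o d q r
  turn⇒¬straight o {hor} (inj₁ (_ , refl)) _ s = next⇒≢ o (next s) refl
  turn⇒¬straight o {hor} (inj₂ (refl , _)) s _ = next⇒≢ o (next s) refl
  turn⇒¬straight o {ver} (inj₁ (refl , _)) s _ = next⇒≢ o (next s) refl
  turn⇒¬straight o {ver} (inj₂ (_ , refl)) _ s = next⇒≢ o (next s) refl

  perp-steps⇒turn : ∀ o {d p q r} → Step o d p q → Step o (perp d) q r → Turn p q r
  perp-steps⇒turn o {hor} s s′ = inj₁ (Fin.toℕ-injective (same s) , Fin.toℕ-injective (same s′))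
  perp-steps⇒turn o {ver} s s′ = inj₂ (Fin.toℕ-injective (same s) , Fin.toℕ-injective (same s′))

  step-edge : Sense → Axis → Point → Point → Edge
  step-edge o d p q = edge d (coord (perp d) p) (lower o (coord d p) (coord d q))

  step⇒joins : ∀ o {d p q} → Step o d p q →
    Joins (step-edge o d p q) p q ⊎ Joins (step-edge o d p q) q p
  step⇒joins up   (step n c) = inj₁ (refl , n , refl , sym c)
  step⇒joins down (step n c) = inj₂ (refl , n , sym c , refl)

  joins⇒axis : ∀ o {d p q} e → Step o d p q → Joins e p q ⊎ Joins e q p → Edge.axis e ≡ d
  joins⇒axis o {d} (edge d′ _ t) s j with d ≟ᵃ d′
  ... | yes d≡d′ = sym d≡d′
  ... | no  d≢d′ with refl ← ≢⇒perp d≢d′ | j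
  ...   | inj₁ (pt , qt , _) = contradiction (trans (sym pt) (trans (same s) qt)) (m≢1+n+m t {0})
  ...   | inj₂ (qt , pt , _) = contradiction (trans (sym qt) (trans (sym (same s)) pt)) (m≢1+n+m t {0})

  joins⇒step-edge : ∀ o {d p q} e → Step o d p q → Joins e p q ⊎ Joins e q p → e ≡ step-edge o d p q
  joins⇒step-edge o e s j with joins⇒axis o e s j
  joins⇒step-edge up   _ s (inj₁ (refl , _ , refl , _)) | refl = refl
  joins⇒step-edge up   _ s (inj₂ (refl , pt , _))       | refl =
    contradiction (trans (next s) (cong suc pt)) (m≢1+n+m _ {1})
  joins⇒step-edge down _ s (inj₁ (refl , qt , _))       | refl =
    contradiction (trans (next s) (cong suc qt)) (m≢1+n+m _ {1})
  joins⇒step-edge down _ s (inj₂ (refl , _ , _ , refl)) | refl = refl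

  traverses-∷ : ∀ o {d p q ps} → Step o d p q → ∀ e →
    (p ∷ q ∷ ps) Traverses e ⇔ (e ≡ step-edge o d p q ⊎ (q ∷ ps) Traverses e)
  traverses-∷ o {d} {p} {q} {ps} s e = mk⇔ fwd bwd
    where
    fwd : (p ∷ q ∷ ps) Traverses e → e ≡ step-edge o d p q ⊎ (q ∷ ps) Traverses e
    fwd (_ , _ , j , inj₁ (here refl)) = inj₁ (joins⇒step-edge o e s (inj₁ j))
    fwd (_ , _ , j , inj₂ (here refl)) = inj₁ (joins⇒step-edge o e s (inj₂ j))
    fwd (_ , _ , j , inj₁ (there k))   = inj₂ (_ , _ , j , inj₁ k)
    fwd (_ , _ , j , inj₂ (there k))   = inj₂ (_ , _ , j , inj₂ k)
    bwd : e ≡ step-edge o d p q ⊎ (q ∷ ps) Traverses e → (p ∷ q ∷ ps) Traverses e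
    bwd (inj₁ refl) with step⇒joins o s
    ... | inj₁ j = p , q , j , inj₁ (here refl)
    ... | inj₂ j = q , p , j , inj₂ (here refl)
    bwd (inj₂ (_ , _ , j , inj₁ k)) = _ , _ , j , inj₁ (there k)
    bwd (inj₂ (_ , _ , j , inj₂ k)) = _ , _ , j , inj₂ (there k)

  -- The first run, along d, may be empty.
  record Walk (o : Sense) (d : Axis) (p : Point) (ps : List Point) (n : ℕ) : Set where
    field
      first      : ℕ
      turns      : List ℕ
      length≡    : length turns ≡ n
      ordered    : Ordered o (coord d p) (coord (perp d) p) (first ∷ turns)
      traverses⇔ : ∀ e → ps Traverses e ⇔ OnWalk o d (coord d p) (coord (perp d) p) (first ∷ turns) e

  open Walk

  walk-stop : ∀ o d p → Walk o d p (p ∷ []) 0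
  walk-stop o d p = record
    { first = coord d p ; turns = [] ; length≡ = refl ; ordered = leq-refl o , tt
    ; traverses⇔ = λ e → mk⇔
        (λ { (_ , _ , _ , inj₁ ()) ; (_ , _ , _ , inj₂ ()) })
        (λ { (inj₁ (_ , _ , within)) → ⊥-elim (¬within-refl o within) }) }

  -- An empty run along `d` is put in front. The transports only replace `perp (perp d)` by `d`.
  walk-turn : ∀ o {d p ps n} → Walk o (perp d) p ps n → Walk o d p ps (suc n)
  walk-turn o {d} {p} {ps} w = record
    { first = coord d p ; turns = first w ∷ turns w ; length≡ = cong suc (length≡ w)
    ; ordered = leq-refl o ,
        subst (λ m → Ordered o (coord (perp d) p) m (first w ∷ turns w)) back (ordered w)
    ; traverses⇔ = λ e → mk⇔
        (λ tr → inj₂ (subst (onWalk e) back (to (traverses⇔ w e) tr)))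
        (λ { (inj₁ (_ , _ , within)) → ⊥-elim (¬within-refl o within)
           ; (inj₂ on) → from (traverses⇔ w e) (subst (onWalk e) (sym back) on) }) }
    where
    onWalk : Edge → ℕ → Set
    onWalk e m = OnWalk o (perp d) (coord (perp d) p) m (first w ∷ turns w) e
    back : coord (perp (perp d)) p ≡ coord d p
    back = cong (λ d → coord d p) (perp-involutive d)

  walk-step : ∀ o {d p q ps n} → Step o d p q → Walk o d q (q ∷ ps) n → Walk o d p (p ∷ q ∷ ps) n
  walk-step o {d} {p} {q} {ps} s w = record
    { first = first w ; turns = turns w ; length≡ = length≡ w
    ; ordered = leq-trans o (next⇒leq o (next s)) (proj₁ (ordered w)) ,
        subst (λ m → Ordered o m _ _) (sym (same s)) (proj₂ (ordered w))
    ; traverses⇔ = λ e → mk⇔ (fwd e ∘ to (traverses-∷ o s e)) (from (traverses-∷ o s e) ∘ bwd e) }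
    where
    fwd : ∀ e → e ≡ step-edge o d p q ⊎ (q ∷ ps) Traverses e →
      OnWalk o d (coord d p) (coord (perp d) p) (first w ∷ turns w) e
    fwd e (inj₁ refl) = inj₁ (refl , refl , within-next⁺ o (next s) (proj₁ (ordered w)) (inj₁ refl))
    fwd e (inj₂ tr) with to (traverses⇔ w e) tr
    ... | inj₁ (d≡ , ℓ≡ , within) =
      inj₁ (d≡ , trans ℓ≡ (sym (same s)) , within-next⁺ o (next s) (proj₁ (ordered w)) (inj₂ within))
    ... | inj₂ on = inj₂ (subst (λ m → OnWalk o (perp d) m (first w) (turns w) e) (sym (same s)) on)
    bwd : ∀ e → OnWalk o d (coord d p) (coord (perp d) p) (first w ∷ turns w) e →
      e ≡ step-edge o d p q ⊎ (q ∷ ps) Traverses e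
    bwd e (inj₁ (refl , refl , within)) with within-next⁻ o (next s) within
    ... | inj₁ refl    = inj₁ refl
    ... | inj₂ within′ = inj₂ (from (traverses⇔ w e) (inj₁ (refl , same s , within′)))
    bwd e (inj₂ on) = inj₂ (from (traverses⇔ w e)
      (inj₂ (subst (λ m → OnWalk o (perp d) m (first w) (turns w) e) (same s) on)))

  countTurns-∷ : ∀ p q r ps {b} → does (turn? p q r) ≡ b →
    countTurns (p ∷ q ∷ r ∷ ps) ≡ (if b then 1 else 0) + countTurns (q ∷ r ∷ ps)
  countTurns-∷ p q r ps refl = refl

  -- The walk is built from its far end. A step along the axis of the following step lengthens the
  -- first run; a step along the other axis opens a new run, exactly where `countTurns` counts a
  -- turn.
  walk : ∀ o {d p q} ps → Step o d p q → Linked (λ p q → ∃ λ d → Step o d p q) (q ∷ ps) →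
    Walk o d p (p ∷ q ∷ ps) (countTurns (p ∷ q ∷ ps))
  walk o [] s [-] = walk-step o s (walk-stop o _ _)
  walk o {d} {p} {q} (r ∷ ps) s ((d′ , s′) ∷ steps) with d ≟ᵃ d′
  ... | yes refl =
    subst (Walk o d p _)
      (sym (countTurns-∷ p q r ps (dec-false (turn? p q r) λ t → turn⇒¬straight o t s s′)))
      (walk-step o s (walk o ps s′ steps))
  ... | no d≢d′ with refl ← ≢⇒perp d≢d′ =
    subst (Walk o d p _)
      (sym (countTurns-∷ p q r ps (dec-true (turn? p q r) (perp-steps⇒turn o s s′))))
      (walk-step o s (walk-turn o (walk o ps s′ steps)))

  path-staircase : ∀ P → Monotonic P → bends P ≤ 2 → ∃ λ S → ∀ e → e ∈ᶜ S ⇔ P Contains e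
  path-staircase P monotonic = go (points P) (nonempty P)
    ([ (λ l → up , Linked.map ascend⇒step l) , (λ l → down , Linked.map descend⇒step l) ]′ monotonic)
    where
    go : ∀ ps → 2 ≤ length ps → (∃ λ o → Linked (λ p q → ∃ λ d → Step o d p q) ps) →
      countTurns ps ≤ 2 → ∃ λ S → ∀ e → e ∈ᶜ S ⇔ ps Traverses e
    go (p ∷ []) (s≤s ()) _ _
    go (p ∷ q ∷ ps) _ (o , (d , s) ∷ steps) turns≤2 =
      let w = walk o ps s steps
          S , S⇔ = walk-staircase o d (coord d p) (coord (perp d) p) (first w) (turns w)
                     (≤-trans (≤-reflexive (length≡ w)) turns≤2) (ordered w)
      in S , λ e → mk⇔ (from (traverses⇔ w e) ∘ to (S⇔ e)) (from (S⇔ e) ∘ to (traverses⇔ w e))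

-- Decision procedures for paths and shared edges.

module _ {cols rows : ℕ} where
  open Grid cols rows

  infix 4 _≟ᵖ_ _∋ᵉ?_
  _≟ᵖ_ : DecidableEquality Point
  _≟ᵖ_ = ≡-dec Fin._≟_ Fin._≟_

  ascend? : Decidable Ascend
  ascend? p q = (toℕ (col q) ≟ suc (toℕ (col p)) ×-dec row p Fin.≟ row q)
          ⊎-dec (col p Fin.≟ col q ×-dec toℕ (row q) ≟ suc (toℕ (row p)))

  gridEdge? : Decidable GridEdge
  gridEdge? p q = ascend? p q ⊎-dec ascend? q p

  IsPath : List Point → Set
  IsPath ps = 2 ≤ length ps × Linked GridEdge ps × Unique ps

  isPath? : ∀ ps → Dec (IsPath ps)
  isPath? ps = 2 ≤? length ps ×-dec linked? gridEdge? ps ×-dec DecUnique.unique? _≟ᵖ_ ps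

  toPath : ∀ ps → IsPath ps → Path
  toPath ps (nonempty , linked , distinct) =
    record { points = ps ; nonempty = nonempty ; linked = linked ; distinct = distinct }

  _∋ᵉ?_ : ∀ P e → Dec (P ∋ᵉ e)
  P ∋ᵉ? (p , q) = (p , q) ∈? edges (points P) ⊎-dec (q , p) ∈? edges (points P)
    where open DecMembership (≡-dec _≟ᵖ_ _≟ᵖ_) using (_∈?_)

  shareEdge-sym : ∀ P Q → ShareEdge P Q → ShareEdge Q P
  shareEdge-sym P Q (p , q , P∋ , Q∋) = p , q , Q∋ , P∋

  shareEdge? : Decidable ShareEdge
  shareEdge? P Q = map′ fwd bwd (any? (Q ∋ᵉ?_) (edges (points P)))
    where
    fwd : Any (Q ∋ᵉ_) (edges (points P)) → ShareEdge P Q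
    fwd common with (p , q) , e∈P , Q∋e ← find common = p , q , inj₁ e∈P , Q∋e
    bwd : ShareEdge P Q → Any (Q ∋ᵉ_) (edges (points P))
    bwd (p , q , inj₁ e∈P , Q∋e)      = lose e∈P Q∋e
    bwd (p , q , inj₂ e∈P , inj₁ e∈Q) = lose e∈P (inj₂ e∈Q)
    bwd (p , q , inj₂ e∈P , inj₂ e∈Q) = lose e∈P (inj₁ e∈Q)

  OwnedBy : ∀ {A : Set} → (Point → Point → A) → A → List Point → Set
  OwnedBy owner a ps = All (λ (p , q) → owner p q ≡ a × owner q p ≡ a) (edges ps)

  -- This serves to show that all rails are disjoint: labelling the edges takes one check per path
  -- instead of one per pair of paths.
  shareEdge⇒owner≡ : ∀ {A : Set} (owner : Point → Point → A) {a b} P Q →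
    OwnedBy owner a (points P) → OwnedBy owner b (points Q) → ShareEdge P Q → a ≡ b
  shareEdge⇒owner≡ owner P Q a-owns b-owns (p , q , P∋ , Q∋) =
    trans (sym (owner≡ P a-owns P∋)) (owner≡ Q b-owns Q∋)
    where
    owner≡ : ∀ {c} R → OwnedBy owner c (points R) → R ∋ᵉ (p , q) → owner p q ≡ c
    owner≡ R owns (inj₁ e) = proj₁ (All.lookup owns e)
    owner≡ R owns (inj₂ e) = proj₂ (All.lookup owns e)

-- The drawing with two bends per path.

Index : Set
Index = Fin 13 × Fin 4

-- The hubs are the two paths a and b joined by the rails. The clasp with index `i` in a group is
-- the one that avoids the rail with index `i`.
Label : Set
Label = Fin 2 ⊎ (Index ⊎ Index)

pattern hub k     = inj₁ k
pattern rail g i  = inj₂ (inj₁ (g , i))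
pattern clasp g i = inj₂ (inj₂ (g , i))

order : ℕ
order = 2 + (13 * 4 + 13 * 4)

labels : Fin order ↔ Label
labels = ↔-trans Fin.+↔⊎ (↔-refl ⊎-↔ ↔-trans Fin.+↔⊎ (Fin.*↔× ⊎-↔ Fin.*↔×))

open Grid 28 28

-- Group g occupies two columns and the two rows with the same numbers.
at before after : Fin 13 → Fin 2 → Fin 28
at     g i = suc (inject₁ (combine g i))
before g i = inject₁ (inject₁ (combine g i))
after  g i = suc (suc (combine g i))

last : Fin 28
last = fromℕ 27

-- A rail borrows one edge from each hub: the edge just before its line on the bottom or left
-- border, and the edge just after its line on the top or right border. Hence `rail-owner` takes a
-- maximum on the former and a minimum on the latter. Hubs and rails are monotonic here; only the
-- clasps are not.
vertical horizontal : Fin 13 → Fin 2 → List Point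
vertical   g i = (before g i , 0F) ∷ map (at g i ,_) (allFin 28) ++ (after g i , last) ∷ []
horizontal g i = (0F , before g i) ∷ map (_, at g i) (allFin 28) ++ (last , after g i) ∷ []

-- The hubs bound the grid, one on the left and at the top, the other one at the
-- bottom and on the right.
drawing : Label → List Point
drawing (hub 0F)     = map (0F ,_) (allFin 28) ++ map (λ i → suc i , last) (allFin 27)
drawing (hub 1F)     = map (_, 0F) (allFin 28) ++ map (λ i → last , suc i) (allFin 27)
drawing (rail g 0F)  = vertical g 0F
drawing (rail g 1F)  = vertical g 1F
drawing (rail g 2F)  = horizontal g 0F
drawing (rail g 3F)  = horizontal g 1F
-- The four lines of a group bound a unit square. A clasp takes one side of it and, from both ends
-- of that side, the perpendicular edge pointing away from the square. The side lies on the rail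
-- parallel to the avoided one.
drawing (clasp g 0F) =
  (after g 1F , at g 0F) ∷ (at g 1F , at g 0F) ∷ (at g 1F , at g 1F) ∷ (after g 1F , at g 1F) ∷ []
drawing (clasp g 1F) =
  (before g 0F , at g 0F) ∷ (at g 0F , at g 0F) ∷ (at g 0F , at g 1F) ∷ (before g 0F , at g 1F) ∷ []
drawing (clasp g 2F) =
  (at g 0F , after g 1F) ∷ (at g 0F , at g 1F) ∷ (at g 1F , at g 1F) ∷ (at g 1F , after g 1F) ∷ []
drawing (clasp g 3F) =
  (at g 0F , before g 0F) ∷ (at g 0F , at g 0F) ∷ (at g 1F , at g 0F) ∷ (at g 1F , before g 0F) ∷ []

-- Facts about the drawing, checked by evaluation.

Valid : Label → Set
Valid l = IsPath (drawing l) × countTurns (drawing l) ≤ 2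

valid? : ∀ l → Dec (Valid l)
valid? l = isPath? (drawing l) ×-dec countTurns (drawing l) ≤? 2

hubs-valid : ∀ k → Valid (hub k)
hubs-valid = from-yes (Fin.all? λ k → valid? (hub k))

rails-valid : ∀ g i → Valid (rail g i)
rails-valid = from-yes (Fin.all? λ g → Fin.all? λ i → valid? (rail g i))

clasps-valid : ∀ g i → Valid (clasp g i)
clasps-valid = from-yes (Fin.all? λ g → Fin.all? λ i → valid? (clasp g i))

drawing-valid : ∀ l → Valid l
drawing-valid (hub k)     = hubs-valid k
drawing-valid (rail g i)  = rails-valid g i
drawing-valid (clasp g i) = clasps-valid g i

drawn : Label → Path
drawn l = toPath (drawing l) (proj₁ (drawing-valid l))

infix 4 _⌢_ _⌢?_
_⌢_ : Label → Label → Set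
l ⌢ l′ = ShareEdge (drawn l) (drawn l′)

_⌢?_ : Decidable _⌢_
l ⌢? l′ = shareEdge? (drawn l) (drawn l′)

hubs-disjoint : ¬ hub 0F ⌢ hub 1F
hubs-disjoint = from-yes (¬? (hub 0F ⌢? hub 1F))

rail⌢hub : ∀ k g i → rail g i ⌢ hub k
rail⌢hub = from-yes (Fin.all? λ k → Fin.all? λ g → Fin.all? λ i → rail g i ⌢? hub k)

clasp-hub-disjoint : ∀ k g i → ¬ clasp g i ⌢ hub k
clasp-hub-disjoint =
  from-yes (Fin.all? λ k → Fin.all? λ g → Fin.all? λ i → ¬? (clasp g i ⌢? hub k))

clasps-disjoint : ∀ g i j → i ≢ j → ¬ clasp g i ⌢ clasp g j
clasps-disjoint = from-yes (Fin.all? λ g → Fin.all? λ i → Fin.all? λ j →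
  ¬? (i Fin.≟ j) →-dec ¬? (clasp g i ⌢? clasp g j))

clasp⌢rail : ∀ g i j → i ≢ j → clasp g i ⌢ rail g j
clasp⌢rail = from-yes (Fin.all? λ g → Fin.all? λ i → Fin.all? λ j →
  ¬? (i Fin.≟ j) →-dec (clasp g i ⌢? rail g j))

track : Index → Axis × ℕ
track (g , 0F) = ver , toℕ (at g 0F)
track (g , 1F) = ver , toℕ (at g 1F)
track (g , 2F) = hor , toℕ (at g 0F)
track (g , 3F) = hor , toℕ (at g 1F)

track-injective : ∀ {i j} → track i ≡ track j → i ≡ j
track-injective {g , i} {h , j} = from-yes
  (Fin.all? λ g → Fin.all? λ i → Fin.all? λ h → Fin.all? λ j →
    ≡-dec _≟ᵃ_ _≟_ (track (g , i)) (track (h , j)) →-dec ≡-dec Fin._≟_ Fin._≟_ (g , i) (h , j))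
  g i h j

-- The track of the only rail that may use the grid edge between two points.
rail-owner : Point → Point → Axis × ℕ
rail-owner (x , y) (x′ , y′) =
  if does (y Fin.≟ y′)
  then (if does (y Fin.≟ 0F)   then ver , toℕ x ⊔ toℕ x′ else
        if does (y Fin.≟ last) then ver , toℕ x ⊓ toℕ x′ else (hor , toℕ y))
  else (if does (x Fin.≟ 0F)   then hor , toℕ y ⊔ toℕ y′ else
        if does (x Fin.≟ last) then hor , toℕ y ⊓ toℕ y′ else (ver , toℕ x))

rail-owned : ∀ g i → OwnedBy rail-owner (track (g , i)) (drawing (rail g i))
rail-owned = from-yes (Fin.all? λ g → Fin.all? λ i → All.all? (λ (p , q) →
  rail-owner p q ≟ᵗ track (g , i) ×-dec rail-owner q p ≟ᵗ track (g , i)) (edges (drawing (rail g i))))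
  where _≟ᵗ_ = ≡-dec _≟ᵃ_ _≟_

rails-disjoint : ∀ {g h i j} → (g , i) ≢ (h , j) → ¬ rail g i ⌢ rail h j
rails-disjoint {g} {h} {i} {j} i≢j = i≢j ∘ track-injective ∘
  shareEdge⇒owner≡ rail-owner (drawn (rail g i)) (drawn (rail h j)) (rail-owned g i) (rail-owned h j)

-- The graph that separates the two classes.

label : Fin order → Label
label = Inverse.to labels

vertex : Label → Fin order
vertex = Inverse.from labels

label-vertex : ∀ l → label (vertex l) ≡ l
label-vertex = Inverse.strictlyInverseˡ labels

-- Adjacency is read off the drawing, so membership in `B 2` is immediate. A path shares edges with
-- itself, whence the condition `v ≢ w`.
claspGraph : Graph
claspGraph = record
  { order  = order
  ; Adj    = λ v w → v ≢ w × label v ⌢ label w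
  ; adj?   = λ v w → ¬? (v Fin.≟ w) ×-dec label v ⌢? label w
  ; sym    = λ {v} {w} (v≢w , share) →
               ≢-sym v≢w , shareEdge-sym (drawn (label v)) (drawn (label w)) share
  ; irrefl = λ v≡w (v≢w , _) → v≢w v≡w
  }

claspGraph∈B₂ : claspGraph ∈ B 2
claspGraph∈B₂ =
  record { cols = 28 ; rows = 28 ; path = drawn ∘ label ; represents = λ _ _ v≢w → mk⇔ proj₂ (v≢w ,_) } ,
  λ v → proj₂ (drawing-valid (label v))

-- The adjacencies and non-adjacencies checked on the drawing carry over to the staircases of an
-- arbitrary monotonic representation, and `no-clasped-rails` rules these out.
claspGraph∉Bᵐ₂ : claspGraph ∉ Bᵐ 2
claspGraph∉Bᵐ₂ (R , monotonic , bends≤2) =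
  no-clasped-rails (λ g i → shape (rail g i)) (λ g i → shape (clasp g i))
    (apart (hub 0F) (hub 1F) (λ ()) hubs-disjoint)
    (λ g i → meet (rail g i) (hub 0F) (λ ()) (rail⌢hub 0F g i))
    (λ g i → meet (rail g i) (hub 1F) (λ ()) (rail⌢hub 1F g i))
    (λ {g} {h} {i} {j} i≢j → apart (rail g i) (rail h j) (λ { refl → i≢j refl }) (rails-disjoint i≢j))
    (λ g i → apart (clasp g i) (hub 0F) (λ ()) (clasp-hub-disjoint 0F g i))
    (λ g i → apart (clasp g i) (hub 1F) (λ ()) (clasp-hub-disjoint 1F g i))
    (λ g {i} {j} i≢j →
      apart (clasp g i) (clasp g j) (λ { refl → i≢j refl }) (clasps-disjoint g i j i≢j))
    (λ g {i} {j} i≢j → meet (clasp g i) (rail g j) (λ ()) (clasp⌢rail g i j i≢j))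
  where
  open EPG R using (path; represents)

  shape : Label → Staircase
  shape l = proj₁ (path-staircase (path (vertex l)) (monotonic _) (bends≤2 _))

  shape⇔ : ∀ l e → e ∈ᶜ shape l ⇔ path (vertex l) Contains e
  shape⇔ l = proj₂ (path-staircase (path (vertex l)) (monotonic _) (bends≤2 _))

  vertex-≢ : ∀ {l l′} → l ≢ l′ → vertex l ≢ vertex l′
  vertex-≢ {l} {l′} l≢l′ v≡v′ =
    l≢l′ (trans (sym (label-vertex l)) (trans (cong label v≡v′) (label-vertex l′)))

  meet : ∀ l l′ → l ≢ l′ → l ⌢ l′ → Meets (shape l) (shape l′)
  meet l l′ l≢l′ l⌢l′ =
    let share = to (represents _ _ (vertex-≢ l≢l′))
                  (vertex-≢ l≢l′ , subst₂ _⌢_ (sym (label-vertex l)) (sym (label-vertex l′)) l⌢l′)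
        e , P∋e , Q∋e = to (shareEdge⇔ (path (vertex l)) (path (vertex l′))) share
    in e , from (shape⇔ l e) P∋e , from (shape⇔ l′ e) Q∋e

  apart : ∀ l l′ → l ≢ l′ → ¬ l ⌢ l′ → ¬ Meets (shape l) (shape l′)
  apart l l′ l≢l′ ¬l⌢l′ (e , e∈S , e∈T) =
    ¬l⌢l′ (subst₂ _⌢_ (label-vertex l) (label-vertex l′) (proj₂ (from (represents _ _ (vertex-≢ l≢l′))
      (from (shareEdge⇔ (path (vertex l)) (path (vertex l′)))
        (e , to (shape⇔ l e) e∈S , to (shape⇔ l′ e) e∈T)))))

theorem3p4 : (Bᵐ 2 ⊆ B 2) × (∃[ G ] (G ∈ B 2 × G ∉ Bᵐ 2))
theorem3p4 = (λ (R , _ , bends≤2) → R , bends≤2) , claspGraph , claspGraph∈B₂ , claspGraph∉Bᵐ₂
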